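{- Let $G$ be a finite group and let $H$ be a non-trivial subgroup of $G$. Then for every integer $a$ and every even integer $b$ with $0\leq a\leq |H|-1$ and $0\leq b\leq |H|$ such that $\gcd(2,|H|-1)$ divides $a$, the subgroup $H$ is an $(a,b)$-regular set of $G$.
   Context: For a finite group $G$ and an inverse-closed subset $S$ of $G\setminus\{1\}$ (i.e. $s\in S$ implies $s^{ -1}\in S$), the Cayley graph $\mathrm{Cay}(G,S)$ is the simple graph with vertex set $G$ in which $x,y\in G$ are adjacent if and only if $yx^{ -1}\in S$. For non-negative integers $a,b$, a subset $C$ of the vertex set of a simple graph $\Gamma$ is an $(a,b)$-regular set in $\Gamma$ if every vertex of $C$ is adjacent to exactly $a$ vertices of $C$ and every vertex outside $C$ is adjacent to exactly $b$ vertices of $C$. A subset $C$ of $G$ is called an $(a,b)$-regular set of $G$ if it is an $(a,b)$-regular set in $\mathrm{Cay}(G,S)$ for some inverse-closed subset $S$ of $G\setminus\{1\}$ (where $S$ may depend on $a$ and $b$). -}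

module Defs where

open import Algebra.Bundles using (Group)
import Algebra.Properties.Group as GroupProperties
open import Data.Fin.Base using (Fin)
open import Data.List.Base using (List; length; filter; tabulate)
open import Data.Nat.Base using (ℕ)
open import Data.Product.Base using (Σ-syntax; _×_; _,_; proj₁; proj₂)
open import Function.Bundles using (Inverse)
open import Level using (Level; _⊔_; 0ℓ) renaming (suc to lsuc)
open import Relation.Binary.Bundles using (Setoid)
open import Relation.Binary.Core using (Rel)
import Relation.Binary.Definitions as B
open import Relation.Binary.PropositionalEquality.Core using (_≡_)
import Relation.Binary.PropositionalEquality.Properties as ≡
open import Relation.Nullary.Decidable.Core using (_×-dec_)
open import Relation.Nullary.Negation.Core using (¬_)
open import Relation.Unary using (Pred; Decidable; _≐_)

record FiniteSetoid (c ℓ : Level) : Set (lsuc (c ⊔ ℓ)) where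
  field
    setoid      : Setoid c ℓ
    size        : ℕ
    enumeration : Inverse setoid (≡.setoid (Fin size))

  open Setoid setoid public

  -- Every element occurs exactly once, up to _≈_.
  elements : List Carrier
  elements = tabulate (Inverse.from enumeration)

-- Membership is required to be decidable: these are the subsets of a finite
-- set that have a cardinality constructively.
record Subset {c ℓ : Level} (X : FiniteSetoid c ℓ) (p : Level) : Set (c ⊔ ℓ ⊔ lsuc p) where
  open FiniteSetoid X
  field
    member  : Pred Carrier p
    member? : Decidable member
    resp    : member B.Respects _≈_

  card : ℕ
  card = length (filter member? elements)

open Subset public using (member; card)

module _ {c ℓ : Level} {X : FiniteSetoid c ℓ} where
  open FiniteSetoid X

  infix 4 _∈_ _∉_
  infixr 7 _∩_

  _∈_ : {p : Level} → Carrier → Subset X p → Set p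
  x ∈ C = member C x

  _∉_ : {p : Level} → Carrier → Subset X p → Set p
  x ∉ C = ¬ (x ∈ C)

  _∩_ : {p q : Level} → Subset X p → Subset X q → Subset X (p ⊔ q)
  C ∩ D = record
    { member  = λ x → x ∈ C × x ∈ D
    ; member? = λ x → Subset.member? C x ×-dec Subset.member? D x
    ; resp    = λ x≈y (x∈C , x∈D) → Subset.resp C x≈y x∈C , Subset.resp D x≈y x∈D
    }

record FiniteSimpleGraph (c ℓ e : Level) : Set (lsuc (c ⊔ ℓ ⊔ e)) where
  field
    vertices : FiniteSetoid c ℓ

  open FiniteSetoid vertices using (Carrier; _≈_)

  field
    Adjacent   : Rel Carrier e
    adjacent?  : B.Decidable Adjacent
    resp       : Adjacent B.Respects₂ _≈_
    symmetric  : B.Symmetric Adjacent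
    irreflexive : B.Irreflexive _≈_ Adjacent

  neighbours : Carrier → Subset vertices e
  neighbours x = record
    { member  = Adjacent x
    ; member? = adjacent? x
    ; resp    = proj₁ resp
    }

module _ {c ℓ e p : Level} (Γ : FiniteSimpleGraph c ℓ e) where
  open FiniteSimpleGraph Γ

  IsRegularSetIn : ℕ → ℕ → Subset vertices p → Set (c ⊔ p)
  IsRegularSetIn a b C =
    (∀ x → x ∈ C → card (neighbours x ∩ C) ≡ a) ×
    (∀ x → x ∉ C → card (neighbours x ∩ C) ≡ b)

record FiniteGroup (c ℓ : Level) : Set (lsuc (c ⊔ ℓ)) where
  field
    group       : Group c ℓ
    order       : ℕ
    enumeration : Inverse (Group.setoid group) (≡.setoid (Fin order))

  open Group group public

  finiteSetoid : FiniteSetoid c ℓ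
  finiteSetoid = record
    { setoid = setoid ; size = order ; enumeration = enumeration }

module _ {c ℓ : Level} (G : FiniteGroup c ℓ) where
  open FiniteGroup G
  open GroupProperties group using (⁻¹-anti-homo-∙; ⁻¹-involutive)

  SubsetOf : (p : Level) → Set (c ⊔ ℓ ⊔ lsuc p)
  SubsetOf p = Subset finiteSetoid p

  record IsSubgroup {p : Level} (H : SubsetOf p) : Set (c ⊔ p) where
    field
      ε-closed  : ε ∈ H
      ∙-closed  : ∀ x y → x ∈ H → y ∈ H → x ∙ y ∈ H
      ⁻¹-closed : ∀ x → x ∈ H → x ⁻¹ ∈ H

  NonTrivial : {p : Level} → SubsetOf p → Set (c ⊔ ℓ ⊔ p)
  NonTrivial H = ¬ (member H ≐ (_≈ ε))

  record IsConnectionSet {p : Level} (S : SubsetOf p) : Set (c ⊔ p) where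
    field
      ε∉S            : ε ∉ S
      inverse-closed : ∀ s → s ∈ S → s ⁻¹ ∈ S

  Cay : {p : Level} (S : SubsetOf p) → IsConnectionSet S → FiniteSimpleGraph c ℓ p
  Cay S isConn = record
    { vertices    = finiteSetoid
    ; Adjacent    = λ x y → y ∙ x ⁻¹ ∈ S
    ; adjacent?   = λ x y → Subset.member? S (y ∙ x ⁻¹)
    ; resp        = (λ y≈z → Subset.resp S (∙-congʳ y≈z))
                  , (λ x≈z → Subset.resp S (∙-congˡ (⁻¹-cong x≈z)))
    ; symmetric   = λ {x} {y} yx⁻¹∈S → Subset.resp S
                      (trans (⁻¹-anti-homo-∙ y (x ⁻¹)) (∙-congʳ (⁻¹-involutive x)))
                      (inverse-closed (y ∙ x ⁻¹) yx⁻¹∈S)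
    ; irreflexive = λ {x} {y} x≈y yx⁻¹∈S → ε∉S
                      (Subset.resp S (trans (∙-congʳ (sym x≈y)) (inverseʳ x)) yx⁻¹∈S)
    }
    where open IsConnectionSet isConn

  -- Taking S at level 0ℓ is no restriction: a decidable predicate is
  -- equivalent to one valued in Set.
  IsRegularSetOf : {p : Level} → ℕ → ℕ → SubsetOf p → Set (c ⊔ ℓ ⊔ p ⊔ lsuc 0ℓ)
  IsRegularSetOf a b C =
    Σ[ S ∈ SubsetOf 0ℓ ] Σ[ conn ∈ IsConnectionSet S ] IsRegularSetIn (Cay S conn) a b C

{-# OPTIONS --safe #-}

-- A connection set S is glued from a part A inside H and a part B outside it.
--
-- Regard s ∈ G as an arc from the right coset Hs to the right coset Hs⁻¹, so
-- that inversion reverses arcs. For x ∉ H the number of neighbours of x in H is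
-- the number of arcs of S leaving Hx⁻¹, so B has to be a symmetric set of arcs
-- of outdegree b. Since y ↦ k y l with k, l ∈ H permutes the arcs, each
-- connected component of this multigraph is complete or complete bipartite with
-- a constant multiplicity m on each of the n cosets adjacent to a given one, and
-- m n = |H|. Numbering the cosets on each side by 0, …, n − 1, take f |i − j|
-- arcs between the i-th and the j-th, where f is palindromic (f d = f (n − d)),
-- bounded by m, and has total b; as b is even, f 0 can be taken to be even or
-- equal to m. Then an inverse-closed set of f 0 loops exists at each coset,
-- whatever the number of involutions among them. The same selection lemma gives
-- an inverse-closed A ⊆ H \ {1} of size a.

module Submission where

open import Defs

open import Algebra.Bundles using (Group; RawGroup)
open import Algebra.Morphism.Structures using (IsGroupMonomorphism)
import Algebra.Morphism.GroupMonomorphism as GroupMonomorphism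
import Algebra.Properties.Group as GroupProperties
import Algebra.Properties.Semiring.Sum as SemiringSum
open import Algebra.Structures using (IsGroup)
open import Data.Bool.Base using (Bool; true; false; if_then_else_; _∧_; _∨_; not; T)
open import Data.Bool.Properties using (∧-assoc; ∧-comm; ∧-identityʳ; ∧-zeroʳ; ∨-comm; T?)
open import Data.Fin.Base using (Fin; zero; suc; toℕ)
open import Data.Fin.Permutation using (Permutation′; permutation)
import Data.Fin.Properties as Fin
open import Data.Fin.Properties using (_≟_; toℕ<n)
open import Data.List.Base using (length; filter; tabulate)
open import Data.Nat.Base
  using (ℕ; zero; suc; pred; _+_; _*_; _∸_; _⊓_; ∣_-_∣; _≤_; _<_;
         z≤n; s≤s; s≤s⁻¹; >-nonZero)
open import Data.Nat.Divisibility
  using (_∣_; divides; divides-refl; _∣0; ∣-refl; ∣-trans; ∣m∣n⇒∣m+n; ∣m+n∣m⇒∣n; n∣m*n)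
open import Data.Nat.GCD using (gcd; gcd-greatest)
import Data.Nat.Properties as ℕ
open import Data.Nat.Properties hiding (_≟_)
open import Data.Nat.Tactic.RingSolver using (solve-∀)
open import Data.Product.Base using (∃-syntax; _×_; _,_; proj₁)
open import Data.Sum.Base using (_⊎_; inj₁; inj₂; [_,_]′)
open import Data.Vec.Functional using (_∷_)
open import Function.Base using (_∘_)
open import Function.Bundles using (Inverse; mk⇔)
open import Level using (Level; 0ℓ)
open import Relation.Binary.PropositionalEquality
  using (_≡_; _≢_; _≗_; refl; sym; trans; cong; cong₂; subst; module ≡-Reasoning)
open import Relation.Nullary using (Dec; yes; no; does; contradiction)
open import Relation.Nullary.Decidable using (dec-true; dec-false; does-⇔)
open import Relation.Unary using (Pred; Decidable)

open SemiringSum +-*-semiring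
  using (sum; sum-syntax; sum-cong-≗; sum-replicate-zero; ∑-comm; ∑-distrib-+; ∑-permute; *-distribʳ-sum)

-- Sums over initial segments of the naturals, and parity.

∑< : ℕ → (ℕ → ℕ) → ℕ
∑< n f = ∑[ i < n ] f (toℕ i)

∑<-snoc : ∀ n f → ∑< (suc n) f ≡ ∑< n f + f n
∑<-snoc zero    f = +-comm (f 0) 0
∑<-snoc (suc n) f = trans (cong (f 0 +_) (∑<-snoc n (f ∘ suc))) (sym (+-assoc (f 0) _ _))

∑<-cong : ∀ n {f g : ℕ → ℕ} → (∀ {i} → i < n → f i ≡ g i) → ∑< n f ≡ ∑< n g
∑<-cong n eq = sum-cong-≗ {n} (λ i → eq (toℕ<n i))

even-or-odd : ∀ n → 2 ∣ n ⊎ 2 ∣ suc n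
even-or-odd zero   = inj₁ (2 ∣0)
even-or-odd (suc n) with even-or-odd n
... | inj₁ 2∣n  = inj₂ (∣m∣n⇒∣m+n (∣-refl {2}) 2∣n)
... | inj₂ 2∣sn = inj₁ 2∣sn

-- The parity condition under which an inverse-closed set of size m has an
-- inverse-closed subset of size k, whatever the number of its involutions.
EvenOrCoeven : ℕ → ℕ → Set
EvenOrCoeven k m = 2 ∣ k ⊎ 2 ∣ m ∸ k

-- Palindromic rows and the circulant arrays built from them.

-- The argument of `q` is the distance from `i` to the nearer end of a row of length `n`.
mirror : (ℕ → ℕ) → ℕ → ℕ → ℕ
mirror q n i = q (i ⊓ (n ∸ suc i))

-- Removing the two ends of a palindrome leaves a palindrome; this is the step by two in `profile`.
mirror-∑ : ∀ q n → ∑< (2 + n) (mirror q (2 + n)) ≡ q 0 + (∑< n (mirror (q ∘ suc) n) + q 0)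
mirror-∑ q n = cong (q 0 +_) (trans (∑<-snoc n (mirror q (2 + n) ∘ suc)) (cong₂ _+_ (∑<-cong n inner) (cong q last)))
  where
  inner : ∀ {i} → i < n → q (suc i ⊓ (n ∸ i)) ≡ q (suc (i ⊓ (n ∸ suc i)))
  inner {i} i<n = cong (λ z → q (suc i ⊓ z)) (+-∸-assoc 1 {n} {suc i} i<n)
  last : suc n ⊓ (n ∸ n) ≡ 0
  last = trans (cong (suc n ⊓_) (n∸n≡0 n)) (⊓-zeroʳ (suc n))

-- A palindromic row: diagonal entry `centre`, and `half` mirrored over the
-- remaining n entries.
record Profile (m n c : ℕ) : Set where
  field
    centre  : ℕ
    half    : ℕ → ℕ
    centre≤ : centre ≤ m
    half≤   : ∀ d → half d ≤ m
    even    : EvenOrCoeven centre m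
    total   : centre + ∑< n (mirror half n) ≡ c * 2

double : ∀ x → x + (x + 0) ≡ x * 2
double = solve-∀

-- Recursion on `n` by two: the outermost mirrored pair takes `c ⊓ m` at each end and the inner row
-- the rest, so the parity of the centre is settled in the two base cases.
profile : ∀ m n c → c * 2 ≤ m * suc n → Profile m n c
profile m zero c c≤ = record
  { centre = c * 2 ; half = λ _ → 0 ; centre≤ = subst (c * 2 ≤_) (*-identityʳ m) c≤
  ; half≤ = λ _ → z≤n ; even = inj₁ (n∣m*n c) ; total = +-identityʳ _ }
profile m (suc zero) c c≤ with even-or-odd c
... | inj₁ 2∣c = record
  { centre = c ; half = λ _ → c ; centre≤ = c≤m
  ; half≤ = λ _ → c≤m ; even = inj₁ 2∣c ; total = double c }
  where
  c≤m = *-cancelʳ-≤ c m 2 c≤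
... | inj₂ 2∣1+c with c ℕ.≟ m
...   | yes refl = record
  { centre = c ; half = λ _ → c ; centre≤ = ≤-refl
  ; half≤ = λ _ → ≤-refl ; even = inj₂ (subst (2 ∣_) (sym (n∸n≡0 c)) (2 ∣0)) ; total = double c }
-- Here `c` is odd and less than `m`: one unit moves to the centre, which becomes even and stays
-- within `m`.
...   | no c≢m = record
  { centre = suc c ; half = λ _ → pred c ; centre≤ = c<m
  ; half≤ = λ _ → ≤-trans pred[n]≤n c≤m ; even = inj₁ 2∣1+c ; total = balanced c 2∣1+c }
  where
  c≤m = *-cancelʳ-≤ c m 2 c≤
  c<m = ≤∧≢⇒< c≤m c≢m
  shift : ∀ x → suc (suc x) + (x + 0) ≡ suc x * 2
  shift = solve-∀
  balanced : ∀ x → 2 ∣ suc x → suc x + (pred x + 0) ≡ x * 2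
  balanced zero    (divides zero ())
  balanced zero    (divides (suc _) ())
  balanced (suc x) _ = shift x
profile m (suc (suc n)) c c≤ = record
  { centre = centre ; half = half′ ; centre≤ = centre≤ ; half≤ = half′≤ ; even = even ; total = total′ }
  where
  x = c ⊓ m
  expand : ∀ m n → m * (3 + n) ≡ m * suc n + m * 2
  expand = solve-∀
  -- Truncated subtraction covers both cases: for `c ≤ m` the outer pair absorbs the whole total,
  -- otherwise it absorbs `m * 2`.
  rest : (c ∸ m) * 2 ≤ m * suc n
  rest = begin
    (c ∸ m) * 2          ≡⟨ *-distribʳ-∸ 2 c m ⟩
    c * 2 ∸ m * 2        ≤⟨ ∸-monoˡ-≤ (m * 2) c≤ ⟩
    m * (3 + n) ∸ m * 2  ≡⟨ cong (_∸ m * 2) (expand m n) ⟩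
    m * suc n + m * 2 ∸ m * 2  ≡⟨ m+n∸n≡m (m * suc n) (m * 2) ⟩
    m * suc n ∎
    where open ≤-Reasoning
  open Profile (profile m n (c ∸ m) rest)
  half′ : ℕ → ℕ
  half′ zero    = x
  half′ (suc d) = half d
  half′≤ : ∀ d → half′ d ≤ m
  half′≤ zero    = m⊓n≤n c m
  half′≤ (suc d) = half≤ d
  regroup : ∀ a x s → a + (x + (s + x)) ≡ (a + s) + x * 2
  regroup = solve-∀
  total′ : centre + ∑< (2 + n) (mirror half′ (2 + n)) ≡ c * 2
  total′ = begin
    centre + ∑< (2 + n) (mirror half′ (2 + n))     ≡⟨ cong (centre +_) (mirror-∑ half′ n) ⟩
    centre + (x + (∑< n (mirror half n) + x))      ≡⟨ regroup centre x _ ⟩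
    centre + ∑< n (mirror half n) + x * 2          ≡⟨ cong (_+ x * 2) total ⟩
    (c ∸ m) * 2 + x * 2                            ≡⟨ *-distribʳ-+ 2 (c ∸ m) x ⟨
    (c ∸ m + x) * 2                                ≡⟨ cong (_* 2) (+-comm (c ∸ m) x) ⟩
    (c ⊓ m + (c ∸ m)) * 2                          ≡⟨ cong (λ z → (z + (c ∸ m)) * 2) (⊓-comm c m) ⟩
    (m ⊓ c + (c ∸ m)) * 2                          ≡⟨ cong (_* 2) (m⊓n+n∸m≡n m c) ⟩
    c * 2 ∎
    where open ≡-Reasoning

-- The row sums are guarded by feasibility, so that `entry` depends on no proof.
record SymmetricArray (m n c : ℕ) : Set where
  field
    entry     : ℕ → ℕ → ℕ
    symmetric : ∀ i j → entry i j ≡ entry j i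
    bounded   : ∀ i j → entry i j ≤ m
    diagonal  : ∀ i → EvenOrCoeven (entry i i) m
    row       : c * 2 ≤ m * n → ∀ {i} → i < n → ∑< n (entry i) ≡ c * 2

-- Passing from row `i` to row `suc i` shifts the entries by one place: `f (suc i)` enters on the
-- left, `f (n ∸ i)` leaves on the right, and the two are equal.
circulant-row : ∀ (f : ℕ → ℕ) n → (∀ {i} → i < n → f (suc i) ≡ f (n ∸ i)) →
  ∀ {i} → i ≤ n → ∑< (suc n) (λ j → f ∣ i - j ∣) ≡ ∑< (suc n) f
circulant-row f n pal {zero}  _   = refl
circulant-row f n pal {suc i} i<n = begin
  f (suc i) + ∑< n (λ j → f ∣ i - j ∣)    ≡⟨ +-comm (f (suc i)) _ ⟩
  ∑< n (λ j → f ∣ i - j ∣) + f (suc i)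
    ≡⟨ cong (∑< n (λ j → f ∣ i - j ∣) +_) (trans (pal i<n) (cong f (sym (m≤n⇒∣m-n∣≡n∸m (<⇒≤ i<n))))) ⟩
  ∑< n (λ j → f ∣ i - j ∣) + f ∣ i - n ∣  ≡⟨ ∑<-snoc n (λ j → f ∣ i - j ∣) ⟨
  ∑< (suc n) (λ j → f ∣ i - j ∣)          ≡⟨ circulant-row f n pal (<⇒≤ i<n) ⟩
  ∑< (suc n) f ∎
  where open ≡-Reasoning

circulant : ∀ m n c → SymmetricArray m n c
circulant m n c with c * 2 ≤? m * n
circulant m n c | no c≰ = record
  { entry = λ _ _ → 0 ; symmetric = λ _ _ → refl ; bounded = λ _ _ → z≤n
  ; diagonal = λ _ → inj₁ (2 ∣0) ; row = λ c≤ → contradiction c≤ c≰ }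
circulant m zero c | yes _ = record
  { entry = λ _ _ → 0 ; symmetric = λ _ _ → refl ; bounded = λ _ _ → z≤n
  ; diagonal = λ _ → inj₁ (2 ∣0) ; row = λ _ () }
circulant m (suc n) c | yes c≤ = record
  { entry     = λ i j → f ∣ i - j ∣
  ; symmetric = λ i j → cong f (∣-∣-comm i j)
  ; bounded   = λ i j → f≤ ∣ i - j ∣
  ; diagonal  = λ i → subst (λ d → EvenOrCoeven (f d) m) (sym (∣n-n∣≡0 i)) even
  ; row       = λ _ i<n → trans (circulant-row f n palindrome (s≤s⁻¹ i<n)) total
  }
  where
  open Profile (profile m n c c≤)
  f : ℕ → ℕ
  f zero    = centre
  f (suc d) = mirror half n d
  f≤ : ∀ d → f d ≤ m
  f≤ zero    = centre≤
  f≤ (suc d) = half≤ _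
  palindrome : ∀ {i} → i < n → f (suc i) ≡ f (n ∸ i)
  palindrome {i} i<n = begin
    half (i ⊓ (n ∸ suc i))                            ≡⟨ cong half (⊓-comm i _) ⟩
    half ((n ∸ suc i) ⊓ i)
      ≡⟨ cong (λ z → half ((n ∸ suc i) ⊓ z)) (m∸[m∸n]≡n (<⇒≤ i<n)) ⟨
    half ((n ∸ suc i) ⊓ (n ∸ (n ∸ i)))                ≡⟨ cong (λ z → half ((n ∸ suc i) ⊓ (n ∸ z))) n∸i ⟩
    f (suc (n ∸ suc i))                               ≡⟨ cong f n∸i ⟨
    f (n ∸ i) ∎
    where
    open ≡-Reasoning
    n∸i : n ∸ i ≡ suc (n ∸ suc i)
    n∸i = +-∸-assoc 1 {n} {suc i} i<n

-- Counting Boolean predicates on `Fin n` and numbering their elements.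

⟦_⟧ : Bool → ℕ
⟦ true ⟧  = 1
⟦ false ⟧ = 0

count : ∀ {n} → (Fin n → Bool) → ℕ
count P = sum (⟦_⟧ ∘ P)

count-cong : ∀ {n} {P Q : Fin n → Bool} → P ≗ Q → count P ≡ count Q
count-cong P≗Q = sum-cong-≗ (cong ⟦_⟧ ∘ P≗Q)

true⇔⇒≡ : ∀ {a b} → (a ≡ true → b ≡ true) → (b ≡ true → a ≡ true) → a ≡ b
true⇔⇒≡ {true}          f g = sym (f refl)
true⇔⇒≡ {false} {true}  f g = g refl
true⇔⇒≡ {false} {false} f g = refl

does-true : ∀ {p} {A : Set p} (a? : Dec A) → does a? ≡ true → A
does-true (yes a) _ = a

-- The number of elements of `P` below `i`; it numbers the elements of `P` from 0.
rank : ∀ {n} → (Fin n → Bool) → Fin n → ℕ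
rank P zero    = 0
rank P (suc i) = ⟦ P zero ⟧ + rank (P ∘ suc) i

rank-cong : ∀ {n} {P Q : Fin n → Bool} → P ≗ Q → ∀ i → rank P i ≡ rank Q i
rank-cong P≗Q zero    = refl
rank-cong P≗Q (suc i) = cong₂ _+_ (cong ⟦_⟧ (P≗Q zero)) (rank-cong (P≗Q ∘ suc) i)

rank<count : ∀ {n} (P : Fin n → Bool) {i} → P i ≡ true → rank P i < count P
rank<count P {zero}  Pi rewrite Pi = s≤s z≤n
rank<count P {suc i} Pi = +-monoʳ-< ⟦ P zero ⟧ (rank<count (P ∘ suc) Pi)

-- On `P` the rank takes each value below `count P` exactly once.
∑-rank : ∀ {n} (P : Fin n → Bool) (g : ℕ → ℕ) →
  ∑[ i < n ] (if P i then g (rank P i) else 0) ≡ ∑< (count P) g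
∑-rank {zero}  P g = refl
∑-rank {suc n} P g with P zero
... | true  = cong (g 0 +_) (∑-rank (P ∘ suc) (g ∘ suc))
... | false = ∑-rank (P ∘ suc) g

-- Regular even weightings of a symmetric multigraph.

-- A submultigraph in which every vertex not isolated in `w` has degree `b`. The `diagonal`
-- condition prepares for an inversion-closed choice of loops.
record EvenWeighting {n} (w : Fin n → Fin n → ℕ) (b : ℕ) : Set where
  field
    weight    : Fin n → Fin n → ℕ
    symmetric : ∀ u v → weight u v ≡ weight v u
    bounded   : ∀ u v → weight u v ≤ w u v
    diagonal  : ∀ u → EvenOrCoeven (weight u u) (w u u)
    row       : ∀ {u v} → 0 < w u v → sum (weight u) ≡ b

-- By `rectangular`, every path u′, v, u, v′ is closed by an edge of the same multiplicity: the
-- local form of complete or complete bipartite components.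
module _ {n} (w : Fin n → Fin n → ℕ)
  (w-sym : ∀ u v → w u v ≡ w v u)
  (rectangular : ∀ {u v u′ v′} → 0 < w u v → 0 < w u v′ → 0 < w u′ v → w u′ v′ ≡ w u v)
  {h} (row-sum : ∀ {u v} → 0 < w u v → sum (w u) ≡ h)
  where

  private
    E : Fin n → Fin n → Bool
    E u v = does (0 <? w u v)

    E⁻ : ∀ {u v} → E u v ≡ true → 0 < w u v
    E⁻ {u} {v} = does-true (0 <? w u v)

    E⁺ : ∀ {u v} → 0 < w u v → E u v ≡ true
    E⁺ {u} {v} = dec-true (0 <? w u v)

    w-pos-sym : ∀ {u v} → 0 < w u v → 0 < w v u
    w-pos-sym {u} {v} = subst (0 <_) (w-sym u v)

    -- By `rectangular` with `u′ = u`, all positive entries of a row are equal.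
    row-size : ∀ {u v} → 0 < w u v → w u v * count (E u) ≡ h
    row-size {u} {v} 0<w = begin
      w u v * count (E u)                     ≡⟨ *-comm (w u v) _ ⟩
      count (E u) * w u v                     ≡⟨ *-distribʳ-sum (w u v) (⟦_⟧ ∘ E u) ⟩
      ∑[ x < n ] (⟦ E u x ⟧ * w u v)          ≡⟨ sum-cong-≗ constant ⟩
      sum (w u)                               ≡⟨ row-sum 0<w ⟩
      h ∎
      where
      open ≡-Reasoning
      constant : ∀ x → ⟦ E u x ⟧ * w u v ≡ w u x
      constant x with E u x in Eux
      ... | true  = trans (+-identityʳ _) (sym (rectangular 0<w (E⁻ Eux) 0<w))
      ... | false = sym (n≤0⇒n≡0 (≮⇒≥ λ 0<wx → contradiction (trans (sym Eux) (E⁺ 0<wx)) λ ()))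

    -- Both sizes are `h` divided by the same multiplicity, so a square array fits the two sides of
    -- a component.
    count-sym : ∀ {u v} → 0 < w u v → count (E u) ≡ count (E v)
    count-sym {u} {v} 0<w = *-cancelˡ-≡ _ _ (w u v) {{>-nonZero 0<w}} (begin
      w u v * count (E u)  ≡⟨ row-size 0<w ⟩
      h                    ≡⟨ row-size (w-pos-sym 0<w) ⟨
      w v u * count (E v)  ≡⟨ cong (_* count (E v)) (w-sym v u) ⟩
      w u v * count (E v)  ∎)
      where open ≡-Reasoning

    -- This makes the number given to `u`, its rank in the neighbourhood of `v`, independent of the
    -- neighbour `v`.
    E-cong : ∀ {u v v′} → 0 < w u v → 0 < w u v′ → E v ≗ E v′
    E-cong 0<w 0<w′ x = true⇔⇒≡ (move 0<w 0<w′) (move 0<w′ 0<w)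
      where
      move : ∀ {u v v′ x} → 0 < w u v → 0 < w u v′ → E v x ≡ true → E v′ x ≡ true
      move p q r = E⁺ (w-pos-sym (subst (0 <_) (sym (rectangular p q (w-pos-sym (E⁻ r)))) p))

  -- An edge receives the array entry indexed by the ranks of its ends, each taken in the
  -- neighbourhood of the other. A loop thus lands on the diagonal, where the parity is guaranteed.
  evenWeighting : ∀ c → c * 2 ≤ h → EvenWeighting w (c * 2)
  evenWeighting c c≤h = record
    { weight    = weight
    ; symmetric = symmetric
    ; bounded   = bounded
    ; diagonal  = diagonal
    ; row       = row
    }
    where
    module A (m s : ℕ) = SymmetricArray (circulant m s c)

    entry : Bool → ℕ → ℕ → ℕ → ℕ → ℕ
    entry e m s i j = if e then A.entry m s i j else 0

    weight : Fin n → Fin n → ℕ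
    weight u v = entry (E u v) (w u v) (count (E u)) (rank (E v) u) (rank (E u) v)

    symmetric : ∀ u v → weight u v ≡ weight v u
    symmetric u v rewrite w-sym v u with E u v in Euv
    ... | false = refl
    ... | true  = trans (A.symmetric (w u v) (count (E u)) (rank (E v) u) (rank (E u) v))
                          (cong (λ s → A.entry (w u v) s (rank (E u) v) (rank (E v) u)) (count-sym (E⁻ Euv)))

    bounded : ∀ u v → weight u v ≤ w u v
    bounded u v with E u v
    ... | true  = A.bounded _ _ _ _
    ... | false = z≤n

    diagonal : ∀ u → EvenOrCoeven (weight u u) (w u u)
    diagonal u with E u u
    ... | true  = A.diagonal _ _ _
    ... | false = inj₁ (2 ∣0)

    row : ∀ {u v} → 0 < w u v → sum (weight u) ≡ c * 2
    row {u} {v} 0<w = begin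
      sum (weight u)                                          ≡⟨ sum-cong-≗ uniform ⟩
      ∑[ x < n ] (if E u x then g (rank (E u) x) else 0)      ≡⟨ ∑-rank (E u) g ⟩
      ∑< (count (E u)) g
        ≡⟨ A.row _ _ (subst (c * 2 ≤_) (sym (row-size 0<w)) c≤h) i<s ⟩
      c * 2 ∎
      where
      open ≡-Reasoning
      g : ℕ → ℕ
      g = A.entry (w u v) (count (E u)) (rank (E v) u)
      i<s : rank (E v) u < count (E u)
      i<s = subst (rank (E v) u <_) (sym (count-sym 0<w)) (rank<count (E v) (E⁺ (w-pos-sym 0<w)))
      uniform : ∀ x → weight u x ≡ (if E u x then g (rank (E u) x) else 0)
      uniform x with E u x in Eux
      ... | false = refl
      ... | true  = cong₂ (λ m i → A.entry m (count (E u)) i (rank (E u) x))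
                         (rectangular 0<w (E⁻ Eux) 0<w) (rank-cong (E-cong (E⁻ Eux) 0<w) u)

-- Boolean subsets of `Fin n` and their sizes.

infix 4 _⊑_

_⊑_ : ∀ {n} → (Fin n → Bool) → (Fin n → Bool) → Set
P ⊑ Q = ∀ {x} → P x ≡ true → Q x ≡ true

infixl 6 _∖_

_∖_ : ∀ {n} → (Fin n → Bool) → (Fin n → Bool) → Fin n → Bool
(P ∖ Q) x = not (Q x) ∧ P x

⁅_⁆ : ∀ {n} → Fin n → Fin n → Bool
⁅ x ⁆ y = does (y ≟ x)

count-⊥ : ∀ n → count {n} (λ _ → false) ≡ 0
count-⊥ = sum-replicate-zero

count-⁅⁆ : ∀ {n} (x : Fin n) → count ⁅ x ⁆ ≡ 1
count-⁅⁆ {suc n} zero    = cong suc (count-⊥ n)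
count-⁅⁆ {suc n} (suc x) = count-⁅⁆ x

count-∨ : ∀ {n} (P Q : Fin n → Bool) → (∀ {x} → P x ≡ true → Q x ≡ false) →
  count (λ x → P x ∨ Q x) ≡ count P + count Q
count-∨ P Q disjoint = trans (sum-cong-≗ pointwise) (∑-distrib-+ (⟦_⟧ ∘ P) (⟦_⟧ ∘ Q))
  where
  pointwise : ∀ x → ⟦ P x ∨ Q x ⟧ ≡ ⟦ P x ⟧ + ⟦ Q x ⟧
  pointwise x with P x in Px
  ... | true  rewrite disjoint Px = refl
  ... | false = refl

count-∖ : ∀ {n} (P Q : Fin n → Bool) → Q ⊑ P → count Q + count (P ∖ Q) ≡ count P
count-∖ P Q Q⊑P = trans (sym (count-∨ Q (P ∖ Q) disjoint)) (count-cong union)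
  where
  disjoint : ∀ {x} → Q x ≡ true → (P ∖ Q) x ≡ false
  disjoint Qx rewrite Qx = refl
  union : ∀ x → Q x ∨ (P ∖ Q) x ≡ P x
  union x with Q x in Qx
  ... | true  = sym (Q⊑P Qx)
  ... | false = refl

∖⇒ : ∀ {n} (P Q : Fin n → Bool) → P ∖ Q ⊑ P
∖⇒ P Q {x} with Q x
... | false = λ Px → Px

∖⇒¬ : ∀ {n} (P Q : Fin n → Bool) {x} → (P ∖ Q) x ≡ true → Q x ≡ false
∖⇒¬ P Q {x} with Q x
... | false = λ _ → refl

count>0⇒∃ : ∀ {n} (P : Fin n → Bool) → 0 < count P → ∃[ x ] P x ≡ true
count>0⇒∃ {suc n} P 0<c with P zero in P0
... | true  = zero , P0
... | false with count>0⇒∃ (P ∘ suc) 0<c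
...   | x , Px = suc x , Px

∃⇒count>0 : ∀ {n} (P : Fin n → Bool) {x} → P x ≡ true → 0 < count P
∃⇒count>0 P Px = ≤-trans (s≤s z≤n) (rank<count P Px)

subset : ∀ {n} (F : Fin n → Bool) {k} → k ≤ count F → ∃[ P ] P ⊑ F × count P ≡ k
subset {n}     F {zero}  _  = (λ _ → false) , (λ ()) , count-⊥ n
subset {suc n} F {suc k} k≤ with F zero in F0
... | false with subset (F ∘ suc) k≤
...   | P , P⊑F , ∣P∣ = (false ∷ P) , (λ { {suc x} → P⊑F }) , ∣P∣
subset {suc n} F {suc k} k≤ | true with subset (F ∘ suc) (s≤s⁻¹ k≤)
...   | P , P⊑F , ∣P∣ = (true ∷ P) , (λ { {zero} _ → F0 ; {suc x} → P⊑F }) , cong suc ∣P∣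

-- Subsets invariant under an involution.

module Involution {n} (ι : Fin n → Fin n) (ι-involutive : ∀ x → ι (ι x) ≡ x) where

  ι-permutation : Permutation′ n
  ι-permutation = permutation ι ι ι-involutive ι-involutive

  Invariant : (Fin n → Bool) → Set
  Invariant P = ∀ x → P (ι x) ≡ P x

  count-∘ι : ∀ P → count (P ∘ ι) ≡ count P
  count-∘ι P = sym (∑-permute (⟦_⟧ ∘ P) ι-permutation)

  ⁅⁆-∘ι : ∀ x y → ⁅ x ⁆ (ι y) ≡ ⁅ ι x ⁆ y
  ⁅⁆-∘ι x y = does-⇔ (mk⇔ (λ e → trans (sym (ι-involutive y)) (cong ι e))
                          (λ e → trans (cong ι e) (ι-involutive x))) (ι y ≟ x) (y ≟ ι x)

  ∖-invariant : ∀ {P Q} → Invariant P → Invariant Q → Invariant (P ∖ Q)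
  ∖-invariant P-inv Q-inv x = cong₂ _∧_ (cong not (Q-inv x)) (P-inv x)

  record InvariantSubset (F : Fin n → Bool) (k : ℕ) : Set where
    field
      member    : Fin n → Bool
      invariant : Invariant member
      ⊑F        : member ⊑ F
      size      : count member ≡ k

  pair : ∀ {F} p q → F p ≡ true → F q ≡ true → p ≢ q →
    Invariant (λ x → ⁅ p ⁆ x ∨ ⁅ q ⁆ x) → InvariantSubset F 2
  pair {F} p q Fp Fq p≢q inv = record
    { member    = λ x → ⁅ p ⁆ x ∨ ⁅ q ⁆ x
    ; invariant = inv
    ; ⊑F        = λ {x} → ⊑F {x}
    ; size      = trans (count-∨ ⁅ p ⁆ ⁅ q ⁆ (λ {x} → disjoint {x})) (cong₂ _+_ (count-⁅⁆ p) (count-⁅⁆ q))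
    }
    where
    ⊑F : (λ x → ⁅ p ⁆ x ∨ ⁅ q ⁆ x) ⊑ F
    ⊑F {x} _ with x ≟ p | x ≟ q
    ⊑F _  | yes refl | _        = Fp
    ⊑F _  | no _     | yes refl = Fq
    ⊑F () | no _     | no _
    disjoint : ∀ {x} → ⁅ p ⁆ x ≡ true → ⁅ q ⁆ x ≡ false
    disjoint {x} x∈p with does-true (x ≟ p) x∈p
    ... | refl = dec-false (p ≟ q) p≢q

  orbit : ∀ {F} → Invariant F → ∀ p → F p ≡ true → ι p ≢ p → InvariantSubset F 2
  orbit {F} F-inv p Fp ιp≢p = pair p (ι p) Fp (trans (F-inv p) Fp) (ιp≢p ∘ sym) λ x → begin
    ⁅ p ⁆ (ι x) ∨ ⁅ ι p ⁆ (ι x)  ≡⟨ cong₂ _∨_ (⁅⁆-∘ι p x) (⁅⁆-∘ι (ι p) x) ⟩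
    ⁅ ι p ⁆ x ∨ ⁅ ι (ι p) ⁆ x    ≡⟨ cong (λ z → ⁅ ι p ⁆ x ∨ ⁅ z ⁆ x) (ι-involutive p) ⟩
    ⁅ ι p ⁆ x ∨ ⁅ p ⁆ x          ≡⟨ ∨-comm (⁅ ι p ⁆ x) _ ⟩
    ⁅ p ⁆ x ∨ ⁅ ι p ⁆ x ∎
    where open ≡-Reasoning

  -- A moved point gives a two-element orbit. If the first point is fixed, a second one is taken:
  -- either it is moved, or the two fixed points form the pair.
  invariantPair : ∀ {F} → Invariant F → 2 ≤ count F → InvariantSubset F 2
  invariantPair {F} F-inv 2≤ with count>0⇒∃ F (≤-trans (s≤s z≤n) 2≤)
  ... | p , Fp with ι p ≟ p
  ...   | no ιp≢p = orbit F-inv p Fp ιp≢p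
  ...   | yes ιp≡p with count>0⇒∃ (F ∖ ⁅ p ⁆) rest
    where
    rest : 0 < count (F ∖ ⁅ p ⁆)
    rest = s≤s⁻¹ (subst (2 ≤_) (trans (sym (count-∖ F ⁅ p ⁆ single)) (cong (_+ count (F ∖ ⁅ p ⁆)) (count-⁅⁆ p))) 2≤)
      where
      single : ⁅ p ⁆ ⊑ F
      single {x} x∈p with does-true (x ≟ p) x∈p
      ... | refl = Fp
  ...     | q , q∈ with ∖⇒ F ⁅ p ⁆ q∈ | ι q ≟ q
  ...       | Fq | no ιq≢q = orbit F-inv q Fq ιq≢q
  ...       | Fq | yes ιq≡q = pair p q Fp Fq p≢q λ x → cong₂ _∨_
    (trans (⁅⁆-∘ι p x) (cong (λ z → ⁅ z ⁆ x) ιp≡p))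
    (trans (⁅⁆-∘ι q x) (cong (λ z → ⁅ z ⁆ x) ιq≡q))
    where
    p≢q : p ≢ q
    p≢q refl = contradiction (trans (sym (dec-true (p ≟ p) refl)) (∖⇒¬ F ⁅ p ⁆ q∈)) λ ()

  -- Pairs are added one at a time: what is left of `F` is again invariant and has at least two
  -- elements.
  evenInvariantSubset : ∀ {F} → Invariant F → ∀ j → j * 2 ≤ count F → InvariantSubset F (j * 2)
  evenInvariantSubset F-inv zero _ = record
    { member = λ _ → false ; invariant = λ _ → refl ; ⊑F = λ () ; size = count-⊥ n }
  evenInvariantSubset {F} F-inv (suc j) j≤ = record
    { member    = λ x → T.member x ∨ U.member x
    ; invariant = λ x → cong₂ _∨_ (T.invariant x) (U.invariant x)
    ; ⊑F        = ⊑F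
    ; size      = trans (count-∨ T.member U.member disjoint)
                    (trans (cong₂ _+_ T.size U.size) (+-comm (j * 2) 2))
    }
    where
    module T = InvariantSubset (evenInvariantSubset F-inv j (≤-trans (m≤n+m (j * 2) 2) j≤))
    rest : 2 ≤ count (F ∖ T.member)
    rest = +-cancelʳ-≤ (j * 2) 2 _ (begin
      2 + j * 2                              ≤⟨ j≤ ⟩
      count F                                ≡⟨ count-∖ F T.member T.⊑F ⟨
      count T.member + count (F ∖ T.member)  ≡⟨ cong (_+ count (F ∖ T.member)) T.size ⟩
      j * 2 + count (F ∖ T.member)           ≡⟨ +-comm (j * 2) _ ⟩
      count (F ∖ T.member) + j * 2           ∎)
      where open ≤-Reasoning
    module U = InvariantSubset (invariantPair (∖-invariant F-inv T.invariant) rest)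
    ⊑F : (λ x → T.member x ∨ U.member x) ⊑ F
    ⊑F {x} x∈ with T.member x in Tx
    ... | true  = T.⊑F Tx
    ... | false = ∖⇒ F T.member (U.⊑F x∈)
    disjoint : ∀ {x} → T.member x ≡ true → U.member x ≡ false
    disjoint {x} Tx with U.member x in Ux
    ... | false = refl
    ... | true  = trans (sym Tx) (∖⇒¬ F T.member (U.⊑F Ux))

  -- For even `k` pairs suffice; otherwise the complement in `F` is built from pairs and removed.
  invariantSubset : ∀ {F} → Invariant F → ∀ {k} → k ≤ count F → EvenOrCoeven k (count F) →
    InvariantSubset F k
  invariantSubset F-inv k≤ (inj₁ (divides-refl j)) = evenInvariantSubset F-inv j k≤
  invariantSubset {F} F-inv {k} k≤ (inj₂ (divides j eq)) = record
    { member    = F ∖ T.member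
    ; invariant = ∖-invariant F-inv T.invariant
    ; ⊑F        = ∖⇒ F T.member
    ; size      = +-cancelˡ-≡ (count F ∸ k) _ k (begin
        count F ∸ k + count (F ∖ T.member)       ≡⟨ cong (_+ count (F ∖ T.member)) (trans T.size (sym eq)) ⟨
        count T.member + count (F ∖ T.member)    ≡⟨ count-∖ F T.member T.⊑F ⟩
        count F                                  ≡⟨ m∸n+n≡m k≤ ⟨
        count F ∸ k + k ∎)
    }
    where
    open ≡-Reasoning
    module T = InvariantSubset (evenInvariantSubset F-inv j (subst (_≤ count F) eq (m∸n≤m _ k)))

-- Inversion-closed sets of arcs with prescribed multiplicities.

⁅⁆-sym : ∀ {n} (x y : Fin n) → ⁅ x ⁆ y ≡ ⁅ y ⁆ x
⁅⁆-sym x y = does-⇔ (mk⇔ sym sym) (y ≟ x) (x ≟ y)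

count-fibres : ∀ {n m} (P : Fin n → Bool) (g : Fin n → Fin m) →
  count P ≡ ∑[ v < m ] count (λ x → P x ∧ ⁅ v ⁆ (g x))
count-fibres {n} {m} P g = trans (sum-cong-≗ single) (∑-comm (λ x v → ⟦ P x ∧ ⁅ v ⁆ (g x) ⟧))
  where
  single : ∀ x → ⟦ P x ⟧ ≡ ∑[ v < m ] ⟦ P x ∧ ⁅ v ⁆ (g x) ⟧
  single x with P x
  ... | true  = trans (sym (count-⁅⁆ (g x))) (count-cong (⁅⁆-sym (g x)))
  ... | false = sym (count-⊥ m)

-- Each s is an arc from r s to r (ι s), and ι reverses arcs.
module Arcs {n} (ι : Fin n → Fin n) (ι-involutive : ∀ x → ι (ι x) ≡ x) (r : Fin n → Fin n) where

  open Involution ι ι-involutive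

  arcs : Fin n → Fin n → Fin n → Bool
  arcs u v s = ⁅ u ⁆ (r s) ∧ ⁅ v ⁆ (r (ι s))

  arcs⁺ : ∀ s → arcs (r s) (r (ι s)) s ≡ true
  arcs⁺ s = cong₂ _∧_ (dec-true (r s ≟ r s) refl) (dec-true (r (ι s) ≟ r (ι s)) refl)

  arcs⁻ : ∀ {u v s} → arcs u v s ≡ true → r s ≡ u × r (ι s) ≡ v
  arcs⁻ {u} {v} {s} _ with r s ≟ u | r (ι s) ≟ v
  arcs⁻ _  | yes rs≡u | yes rιs≡v = rs≡u , rιs≡v
  arcs⁻ () | yes _    | no _
  arcs⁻ () | no _     | _

  arcs-∘ι : ∀ u v s → arcs u v (ι s) ≡ arcs v u s
  arcs-∘ι u v s = trans (∧-comm (⁅ u ⁆ (r (ι s))) _)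
    (cong (λ z → ⁅ v ⁆ (r z) ∧ ⁅ u ⁆ (r (ι s))) (ι-involutive s))

  multiplicity : Fin n → Fin n → ℕ
  multiplicity u v = count (arcs u v)

  multiplicity-sym : ∀ u v → multiplicity u v ≡ multiplicity v u
  multiplicity-sym u v = trans (sym (count-∘ι (arcs u v))) (count-cong (arcs-∘ι u v))

  outdegree : ∀ u → count (λ s → ⁅ u ⁆ (r s)) ≡ sum (multiplicity u)
  outdegree u = count-fibres (λ s → ⁅ u ⁆ (r s)) (r ∘ ι)

  module _ {b} (W : EvenWeighting multiplicity b) where

    open EvenWeighting W

    private
      -- Invariance concerns loops only: `ι` sends arcs between distinct vertices to the opposite
      -- direction, so these are picked freely.
      record Selection (u v : Fin n) : Set where
        field
          chosen    : Fin n → Bool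
          ⊑arcs     : chosen ⊑ arcs u v
          size      : count chosen ≡ weight u v
          invariant : u ≡ v → Invariant chosen
      open Selection

      selection : ∀ u v → Selection u v
      selection u v with u ≟ v
      ... | yes refl = record
        { chosen = T.member ; ⊑arcs = T.⊑F ; size = T.size ; invariant = λ _ → T.invariant }
        where module T = InvariantSubset (invariantSubset (arcs-∘ι u u) (bounded u u) (diagonal u))
      ... | no u≢v with subset (arcs u v) (bounded u v)
      ...   | P , P⊑ , ∣P∣ = record
        { chosen = P ; ⊑arcs = P⊑ ; size = ∣P∣ ; invariant = λ u≡v → contradiction u≡v u≢v }

      -- Selections for the two directions need not be mutually inverse, so only the one with the
      -- smaller vertex first is used, and reversed for the other direction.
      oriented : Fin n → Fin n → Fin n → Bool
      oriented u v s = [ (λ _ → chosen (selection u v) s) , (λ _ → chosen (selection v u) (ι s)) ]′ (Fin.≤-total u v)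

      oriented-∘ι : ∀ u v s → oriented v u (ι s) ≡ oriented u v s
      oriented-∘ι u v s with Fin.≤-total u v | Fin.≤-total v u
      ... | inj₁ _   | inj₂ _   = cong (chosen (selection u v)) (ι-involutive s)
      ... | inj₂ _   | inj₁ _   = refl
      -- Opposite inequalities force equal ends, and the selected loops are invariant.
      ... | inj₁ u≤v | inj₁ v≤u with Fin.≤-antisym u≤v v≤u
      ...   | refl = invariant (selection u u) refl s
      oriented-∘ι u v s | inj₂ v≤u | inj₂ u≤v with Fin.≤-antisym u≤v v≤u
      ...   | refl = invariant (selection u u) refl (ι s)

      oriented⊑arcs : ∀ u v → oriented u v ⊑ arcs u v
      oriented⊑arcs u v {s} with Fin.≤-total u v
      ... | inj₁ _ = ⊑arcs (selection u v)
      ... | inj₂ _ = λ s∈ → trans (sym (arcs-∘ι v u s)) (⊑arcs (selection v u) s∈)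

      oriented-size : ∀ u v → count (oriented u v) ≡ weight u v
      oriented-size u v with Fin.≤-total u v
      ... | inj₁ _ = size (selection u v)
      ... | inj₂ _ = trans (count-∘ι (chosen (selection v u))) (trans (size (selection v u)) (symmetric v u))

    -- Each `s` belongs to exactly one class of arcs, so the union of all selections is tested at
    -- the ends of `s` itself.
    factor : Fin n → Bool
    factor s = oriented (r s) (r (ι s)) s

    factor-invariant : Invariant factor
    factor-invariant s = trans (cong (λ z → oriented (r (ι s)) (r z) (ι s)) (ι-involutive s))
                               (oriented-∘ι (r s) (r (ι s)) s)

    factor-outdegree : ∀ s → count (λ t → factor t ∧ ⁅ r s ⁆ (r t)) ≡ b
    factor-outdegree s = begin
      count (λ t → factor t ∧ ⁅ u ⁆ (r t))                                  ≡⟨ count-fibres _ (r ∘ ι) ⟩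
      ∑[ v < n ] count (λ t → (factor t ∧ ⁅ u ⁆ (r t)) ∧ ⁅ v ⁆ (r (ι t)))
        ≡⟨ sum-cong-≗ (λ v → trans (count-cong (restrict v)) (oriented-size u v)) ⟩
      sum (weight u)
        -- `row` asks for an arc leaving `u`, and `s` is one.
        ≡⟨ row (∃⇒count>0 (arcs u (r (ι s))) (arcs⁺ s)) ⟩
      b ∎
      where
      open ≡-Reasoning
      u = r s
      restrict : ∀ v t → (factor t ∧ ⁅ u ⁆ (r t)) ∧ ⁅ v ⁆ (r (ι t)) ≡ oriented u v t
      restrict v t = trans (∧-assoc (factor t) _ _) (true⇔⇒≡ to from)
        where
        to : factor t ∧ arcs u v t ≡ true → oriented u v t ≡ true
        to t∈ with factor t in ft
        ... | true with arcs⁻ t∈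
        ...   | p , q = trans (cong₂ (λ x y → oriented x y t) (sym p) (sym q)) ft
        from : oriented u v t ≡ true → factor t ∧ arcs u v t ≡ true
        from t∈ with arcs⁻ {u} {v} {t} (oriented⊑arcs u v t∈)
        ... | p , refl = cong₂ _∧_ (trans (cong (λ z → oriented z (r (ι t)) t) p) t∈) (oriented⊑arcs u v t∈)

-- Parity from the gcd, and least witnesses.

-- An even `q` puts a factor 2 into the gcd, hence into `a`; if `a` and `q` are both odd, their
-- difference is even.
gcd∣⇒evenOrCoeven : ∀ {a q} → a ≤ q → gcd 2 q ∣ a → EvenOrCoeven a q
gcd∣⇒evenOrCoeven {a} {q} a≤q gcd∣a with even-or-odd a
... | inj₁ 2∣a   = inj₁ 2∣a
... | inj₂ 2∣1+a with even-or-odd q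
...   | inj₁ 2∣q   = inj₁ (∣-trans (gcd-greatest (∣-refl {2}) 2∣q) gcd∣a)
...   | inj₂ 2∣1+q = inj₂ (∣m+n∣m⇒∣n (subst (2 ∣_) (sym (cong suc (m+[n∸m]≡n a≤q))) 2∣1+q) 2∣1+a)

-- A point `d` satisfying `P` bounds the search, so the result is the least such point and does not
-- depend on `d`.
first : ∀ {n} → (Fin n → Bool) → Fin n → Fin n
first P zero    = zero
first P (suc d) = if P zero then zero else suc (first (P ∘ suc) d)

first-holds : ∀ {n} (P : Fin n → Bool) {d} → P d ≡ true → P (first P d) ≡ true
first-holds P {zero}  Pd = Pd
first-holds P {suc d} Pd with P zero in P0
... | true  = P0
... | false = first-holds (P ∘ suc) Pd

first-cong : ∀ {n} (P Q : Fin n → Bool) → P ≗ Q → ∀ {d e} → P d ≡ true → Q e ≡ true →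
  first P d ≡ first Q e
first-cong P Q P≗Q {zero}  {zero}  Pd Qe = refl
first-cong P Q P≗Q {zero}  {suc e} Pd Qe rewrite trans (sym (P≗Q zero)) Pd = refl
first-cong P Q P≗Q {suc d} {zero}  Pd Qe rewrite trans (P≗Q zero) Qe = refl
first-cong P Q P≗Q {suc d} {suc e} Pd Qe rewrite P≗Q zero with Q zero
... | true  = refl
... | false = cong suc (first-cong (P ∘ suc) (Q ∘ suc) (P≗Q ∘ suc) Pd Qe)

-- A subgroup of a group on `Fin n`: right cosets and the arcs between them.

module FinSubgroup {n} {_∙_ : Fin n → Fin n → Fin n} {ε : Fin n} {_⁻¹ : Fin n → Fin n}
  (isGroup : IsGroup _≡_ _∙_ ε _⁻¹)
  (h : Fin n → Bool) (h-ε : h ε ≡ true)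
  (h-∙ : ∀ {x y} → h x ≡ true → h y ≡ true → h (x ∙ y) ≡ true)
  (h-⁻¹ : ∀ {x} → h x ≡ true → h (x ⁻¹) ≡ true)
  where

  open IsGroup isGroup using (assoc; inverseʳ)

  private
    G : Group 0ℓ 0ℓ
    G = record { isGroup = isGroup }

  open GroupProperties G
    using (⁻¹-anti-homo-∙; ⁻¹-involutive; ε⁻¹≈ε;
           \\-leftDividesˡ; \\-leftDividesʳ; //-rightDividesˡ; //-rightDividesʳ)
  open Involution _⁻¹ ⁻¹-involutive

  private
    telescope : ∀ x y z → (x ∙ (y ⁻¹)) ∙ (y ∙ z) ≡ x ∙ z
    telescope x y z = trans (assoc x (y ⁻¹) (y ∙ z)) (cong (x ∙_) (\\-leftDividesʳ y z))

    //-inverse : ∀ x y → (x ∙ (y ⁻¹)) ⁻¹ ≡ y ∙ (x ⁻¹)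
    //-inverse x y = trans (⁻¹-anti-homo-∙ x (y ⁻¹)) (cong (_∙ (x ⁻¹)) (⁻¹-involutive y))

    h-invariant : Invariant h
    h-invariant x = true⇔⇒≡ (λ hx⁻¹ → subst (λ z → h z ≡ true) (⁻¹-involutive x) (h-⁻¹ hx⁻¹)) h-⁻¹

    infix 4 _∼_

    -- Equality of the right cosets Hs and Ht.
    _∼_ : Fin n → Fin n → Set
    s ∼ t = h (s ∙ (t ⁻¹)) ≡ true

    ∼-refl : ∀ s → s ∼ s
    ∼-refl s = trans (cong h (inverseʳ s)) h-ε

    ∼-sym : ∀ {s t} → s ∼ t → t ∼ s
    ∼-sym {s} {t} s∼t = subst (λ z → h z ≡ true) (//-inverse s t) (h-⁻¹ s∼t)

    ∼-trans : ∀ {s t u} → s ∼ t → t ∼ u → s ∼ u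
    ∼-trans {s} {t} {u} s∼t t∼u = subst (λ z → h z ≡ true) (telescope s t (u ⁻¹)) (h-∙ s∼t t∼u)

    -- The least element of Hs, so that equal cosets become equal vertices in `Fin n`.
    representative : Fin n → Fin n
    representative s = first (λ y → h (y ∙ (s ⁻¹))) s

    representative-∼ : ∀ s → representative s ∼ s
    representative-∼ s = first-holds (λ y → h (y ∙ (s ⁻¹))) (∼-refl s)

    representative-cong : ∀ {s t} → s ∼ t → representative s ≡ representative t
    representative-cong {s} {t} s∼t = first-cong _ _
      (λ y → true⇔⇒≡ {h (y ∙ (s ⁻¹))} {h (y ∙ (t ⁻¹))} (λ y∼s → ∼-trans y∼s s∼t) (λ y∼t → ∼-trans y∼t (∼-sym s∼t)))
      (∼-refl s) (∼-refl t)

    same-coset : ∀ s t → ⁅ representative t ⁆ (representative s) ≡ h (s ∙ (t ⁻¹))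
    same-coset s t = true⇔⇒≡
      (λ e → ∼-trans (∼-sym (representative-∼ s))
               (subst (_∼ t) (sym (does-true (representative s ≟ representative t) e)) (representative-∼ t)))
      (λ s∼t → dec-true (representative s ≟ representative t) (representative-cong s∼t))

    representative-left : ∀ {k} y → h k ≡ true → representative (k ∙ y) ≡ representative y
    representative-left {k} y hk = representative-cong (trans (cong h (//-rightDividesʳ y k)) hk)

    same-coset-right : ∀ k s y →
      ⁅ representative (s ∙ k) ⁆ (representative (y ∙ k)) ≡ ⁅ representative s ⁆ (representative y)
    same-coset-right k s y = begin
      ⁅ representative (s ∙ k) ⁆ (representative (y ∙ k))  ≡⟨ same-coset (y ∙ k) (s ∙ k) ⟩
      h ((y ∙ k) ∙ ((s ∙ k) ⁻¹))                           ≡⟨ cong (λ z → h ((y ∙ k) ∙ z)) (⁻¹-anti-homo-∙ s k) ⟩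
      h ((y ∙ k) ∙ ((k ⁻¹) ∙ (s ⁻¹)))
        ≡⟨ cong h (trans (assoc y k _) (cong (y ∙_) (\\-leftDividesˡ k (s ⁻¹)))) ⟩
      h (y ∙ (s ⁻¹))                                       ≡⟨ same-coset y s ⟨
      ⁅ representative s ⁆ (representative y) ∎
      where open ≡-Reasoning

    right-translation : Fin n → Permutation′ n
    right-translation x = permutation (_∙ x) (_∙ (x ⁻¹)) (//-rightDividesˡ x) (//-rightDividesʳ x)

    left-translation : Fin n → Permutation′ n
    left-translation x = permutation (x ∙_) ((x ⁻¹) ∙_) (\\-leftDividesˡ x) (\\-leftDividesʳ x)

  open Arcs _⁻¹ ⁻¹-involutive representative

  private
    outdegree-coset : ∀ x → sum (multiplicity (representative x)) ≡ count h
    outdegree-coset x = begin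
      sum (multiplicity (representative x))                     ≡⟨ outdegree (representative x) ⟨
      count (λ s → ⁅ representative x ⁆ (representative s))     ≡⟨ count-cong (λ s → same-coset s x) ⟩
      count (λ s → h (s ∙ (x ⁻¹)))                              ≡⟨ ∑-permute (⟦_⟧ ∘ h) (right-translation (x ⁻¹)) ⟨
      count h ∎
      where open ≡-Reasoning

    row-sum : ∀ {u v} → 0 < multiplicity u v → sum (multiplicity u) ≡ count h
    row-sum {u} {v} 0<m with count>0⇒∃ (arcs u v) 0<m
    ... | s , s∈ = trans (cong (sum ∘ multiplicity) (sym (proj₁ (arcs⁻ {u} {v} s∈)))) (outdegree-coset s)

    -- y ↦ k y l with k, l ∈ H maps Hs ∩ sH onto H(sl) ∩ (ks)H.
    multiplicity-translate : ∀ {k l} s → h k ≡ true → h l ≡ true →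
      multiplicity (representative (s ∙ l)) (representative ((s ⁻¹) ∙ (k ⁻¹)))
        ≡ multiplicity (representative s) (representative (s ⁻¹))
    multiplicity-translate {k} {l} s hk hl = begin
      multiplicity (representative (s ∙ l)) (representative ((s ⁻¹) ∙ (k ⁻¹)))
        ≡⟨ ∑-permute _ (left-translation k) ⟩
      count (λ y → arcs (representative (s ∙ l)) (representative ((s ⁻¹) ∙ (k ⁻¹))) (k ∙ y))
        ≡⟨ ∑-permute _ (right-translation l) ⟩
      count (λ y → arcs (representative (s ∙ l)) (representative ((s ⁻¹) ∙ (k ⁻¹))) (k ∙ (y ∙ l)))
        ≡⟨ count-cong (λ y → cong₂ _∧_ (source y) (target y)) ⟩
      multiplicity (representative s) (representative (s ⁻¹)) ∎
      where
      open ≡-Reasoning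
      source : ∀ y → ⁅ representative (s ∙ l) ⁆ (representative (k ∙ (y ∙ l))) ≡ ⁅ representative s ⁆ (representative y)
      source y = trans (cong ⁅ representative (s ∙ l) ⁆ (representative-left (y ∙ l) hk)) (same-coset-right l s y)
      inverse : ∀ y → (k ∙ (y ∙ l)) ⁻¹ ≡ (l ⁻¹) ∙ ((y ⁻¹) ∙ (k ⁻¹))
      inverse y = begin
        (k ∙ (y ∙ l)) ⁻¹               ≡⟨ ⁻¹-anti-homo-∙ k (y ∙ l) ⟩
        ((y ∙ l) ⁻¹) ∙ (k ⁻¹)          ≡⟨ cong (_∙ (k ⁻¹)) (⁻¹-anti-homo-∙ y l) ⟩
        ((l ⁻¹) ∙ (y ⁻¹)) ∙ (k ⁻¹)     ≡⟨ assoc _ _ _ ⟩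
        (l ⁻¹) ∙ ((y ⁻¹) ∙ (k ⁻¹)) ∎
      -- Inversion exchanges the translations: `l ⁻¹` is absorbed on the left and `k ⁻¹` acts on the
      -- right.
      target : ∀ y → ⁅ representative ((s ⁻¹) ∙ (k ⁻¹)) ⁆ (representative ((k ∙ (y ∙ l)) ⁻¹))
                   ≡ ⁅ representative (s ⁻¹) ⁆ (representative (y ⁻¹))
      target y = trans
        (cong ⁅ representative ((s ⁻¹) ∙ (k ⁻¹)) ⁆
          (trans (cong representative (inverse y)) (representative-left ((y ⁻¹) ∙ (k ⁻¹)) (h-⁻¹ hl))))
        (same-coset-right (k ⁻¹) (s ⁻¹) (y ⁻¹))

    representative⁻ : ∀ {s t u} → representative s ≡ u → representative t ≡ u → s ∼ t
    representative⁻ {s} {t} refl e = trans (sym (same-coset s t)) (dec-true (representative s ≟ representative t) (sym e))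

    -- For arcs `s` from `u` to `v`, `s′` from `u` to `v′` and `s″` from `u′` to `v`, the elements k
    -- = s′s⁻¹ and l = s⁻¹s″ lie in H, and translation by them moves the ends `u`, `v` to `u′`,
    -- `v′`.
    rectangular : ∀ {u v u′ v′} → 0 < multiplicity u v → 0 < multiplicity u v′ → 0 < multiplicity u′ v →
      multiplicity u′ v′ ≡ multiplicity u v
    rectangular {u} {v} {u′} {v′} p p′ p″
      with count>0⇒∃ (arcs u v) p | count>0⇒∃ (arcs u v′) p′ | count>0⇒∃ (arcs u′ v) p″
    ... | s , s∈ | s′ , s′∈ | s″ , s″∈
      with arcs⁻ {u} {v} s∈ | arcs⁻ {u} {v′} s′∈ | arcs⁻ {u′} {v} s″∈
    ... | su , sv | s′u , s′v | s″u , s″v = begin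
      multiplicity u′ v′
        ≡⟨ cong₂ multiplicity (trans (sym s″u) (cong representative (sym sl))) (trans (sym s′v) (cong representative (sym sk))) ⟩
      multiplicity (representative (s ∙ l)) (representative ((s ⁻¹) ∙ (k ⁻¹)))
        ≡⟨ multiplicity-translate s (representative⁻ s′u su) (representative⁻ sv s″v) ⟩
      multiplicity (representative s) (representative (s ⁻¹))                   ≡⟨ cong₂ multiplicity su sv ⟩
      multiplicity u v ∎
      where
      open ≡-Reasoning
      k = s′ ∙ (s ⁻¹)
      -- The double inverse makes membership of `l` in H literally `(s ⁻¹) ∼ (s″ ⁻¹)`.
      l = (s ⁻¹) ∙ ((s″ ⁻¹) ⁻¹)
      sl : s ∙ l ≡ s″
      sl = trans (\\-leftDividesˡ s _) (⁻¹-involutive s″)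
      sk : (s ⁻¹) ∙ (k ⁻¹) ≡ s′ ⁻¹
      sk = trans (cong ((s ⁻¹) ∙_) (//-inverse s′ s)) (\\-leftDividesʳ s (s′ ⁻¹))

  -- Gluing the connection set from its two parts.

  record RegularConnectionSet (a b : ℕ) : Set where
    field
      S              : Fin n → Bool
      ε∉S            : S ε ≡ false
      inverse-closed : ∀ s → S (s ⁻¹) ≡ S s
      inside         : ∀ {x} → h x ≡ true → count (λ y → S (y ∙ (x ⁻¹)) ∧ h y) ≡ a
      outside        : ∀ {x} → h x ≡ false → count (λ y → S (y ∙ (x ⁻¹)) ∧ h y) ≡ b

  private
    -- Substituting y = sx, the neighbours of x in H are counted by the s in `S` with sx in H. For x
    -- in H these s make up `A`; for x outside H they are the members of `B` in Hx⁻¹.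
    glue : ∀ {a b} (A B : Fin n → Bool) → Invariant A → Invariant B →
      A ⊑ h ∖ ⁅ ε ⁆ → count A ≡ a → (∀ x → count (λ s → B s ∧ h (s ∙ (x ⁻¹))) ≡ b) →
      RegularConnectionSet a b
    glue {a} {b} A B A-inv B-inv A⊑ A-size B-size = record
      { S              = S
      ; ε∉S            = trans (cong (if_then A ε else B ε) h-ε) ε∉A
      ; inverse-closed = inverse-closed
      ; inside         = inside
      ; outside        = outside
      }
      where
      S : Fin n → Bool
      S s = if h s then A s else B s

      ε∉A : A ε ≡ false
      ε∉A with A ε in Aε
      ... | false = refl
      ... | true  = trans (sym (dec-true (ε ≟ ε) refl)) (∖⇒¬ h ⁅ ε ⁆ (A⊑ Aε))

      inverse-closed : ∀ s → S (s ⁻¹) ≡ S s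
      inverse-closed s rewrite h-invariant s | A-inv s | B-inv s = refl

      translate : ∀ x → count (λ y → S (y ∙ (x ⁻¹)) ∧ h y) ≡ count (λ s → S s ∧ h (s ∙ x))
      translate x = trans (∑-permute _ (right-translation x))
        (count-cong λ s → cong (λ z → S z ∧ h (s ∙ x)) (//-rightDividesʳ x s))

      h-∙ʳ : ∀ {s x} → h x ≡ true → h (s ∙ x) ≡ h s
      h-∙ʳ {s} {x} hx = true⇔⇒≡
        (λ hsx → subst (λ z → h z ≡ true) (//-rightDividesʳ x s) (h-∙ hsx (h-⁻¹ hx)))
        (λ hs → h-∙ hs hx)

      h-∙ˡ : ∀ {s x} → h s ≡ true → h (s ∙ x) ≡ h x
      h-∙ˡ {s} {x} hs = true⇔⇒≡
        (λ hsx → subst (λ z → h z ≡ true) (\\-leftDividesʳ s x) (h-∙ (h-⁻¹ hs) hsx))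
        (h-∙ hs)

      inside : ∀ {x} → h x ≡ true → count (λ y → S (y ∙ (x ⁻¹)) ∧ h y) ≡ a
      inside {x} hx = trans (translate x) (trans (count-cong pointwise) A-size)
        where
        pointwise : ∀ s → S s ∧ h (s ∙ x) ≡ A s
        pointwise s with h s in hs
        ... | true  = trans (cong (A s ∧_) (trans (h-∙ʳ hx) hs)) (∧-identityʳ (A s))
        ... | false with A s in As
        ...   | false = trans (cong (B s ∧_) (trans (h-∙ʳ hx) hs)) (∧-zeroʳ (B s))
        ...   | true  = contradiction (trans (sym hs) (∖⇒ h ⁅ ε ⁆ (A⊑ As))) λ ()

      outside : ∀ {x} → h x ≡ false → count (λ y → S (y ∙ (x ⁻¹)) ∧ h y) ≡ b
      outside {x} hx = begin
        count (λ y → S (y ∙ (x ⁻¹)) ∧ h y)               ≡⟨ translate x ⟩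
        count (λ s → S s ∧ h (s ∙ x))                    ≡⟨ count-cong pointwise ⟩
        count (λ s → B s ∧ h (s ∙ ((x ⁻¹) ⁻¹)))          ≡⟨ B-size (x ⁻¹) ⟩
        b ∎
        where
        open ≡-Reasoning
        -- Members of `B` inside H are lost in the gluing, but for x outside H the coset Hx⁻¹ misses
        -- H.
        drop-inside : ∀ s → S s ∧ h (s ∙ x) ≡ B s ∧ h (s ∙ x)
        drop-inside s with h s in hs
        ... | false = refl
        ... | true rewrite trans (h-∙ˡ {s} {x} hs) hx = trans (∧-zeroʳ (A s)) (sym (∧-zeroʳ (B s)))
        pointwise : ∀ s → S s ∧ h (s ∙ x) ≡ B s ∧ h (s ∙ ((x ⁻¹) ⁻¹))
        pointwise s = trans (drop-inside s) (cong (λ z → B s ∧ h (s ∙ z)) (sym (⁻¹-involutive x)))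

  regularConnectionSet : ∀ a c → a ≤ count h ∸ 1 → c * 2 ≤ count h → EvenOrCoeven a (count h ∸ 1) →
    RegularConnectionSet a (c * 2)
  regularConnectionSet a c a≤ c≤ a-parity =
    glue A.member (factor W) A.invariant (factor-invariant W) A.⊑F A.size λ x →
      trans (count-cong λ s → cong (factor W s ∧_) (sym (same-coset s x))) (factor-outdegree W x)
    where
    punctured : Fin n → Bool
    punctured = h ∖ ⁅ ε ⁆

    punctured-size : count punctured ≡ count h ∸ 1
    punctured-size = cong pred (trans (cong (_+ count punctured) (sym (count-⁅⁆ ε))) (count-∖ h ⁅ ε ⁆ ε∈h))
      where
      ε∈h : ⁅ ε ⁆ ⊑ h
      ε∈h {x} x≡ε = trans (cong h (does-true (x ≟ ε) x≡ε)) h-ε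

    punctured-invariant : Invariant punctured
    punctured-invariant = ∖-invariant h-invariant λ x → trans (⁅⁆-∘ι ε x) (cong (λ z → ⁅ z ⁆ x) ε⁻¹≈ε)

    module A = InvariantSubset (invariantSubset punctured-invariant
      (subst (a ≤_) (sym punctured-size) a≤) (subst (EvenOrCoeven a) (sym punctured-size) a-parity))

    W : EvenWeighting multiplicity (c * 2)
    W = evenWeighting multiplicity multiplicity-sym rectangular row-sum c c≤

-- Transport along the enumeration of a finite group.

length-filter-tabulate : ∀ {a p} {A : Set a} {P : Pred A p} (P? : Decidable P) {n} (f : Fin n → A) →
  length (filter P? (tabulate f)) ≡ count (λ i → does (P? (f i)))
length-filter-tabulate P? {zero}  f = refl
length-filter-tabulate P? {suc n} f with does (P? (f zero))
... | true  = cong suc (length-filter-tabulate P? (f ∘ suc))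
... | false = length-filter-tabulate P? (f ∘ suc)

module _ {c ℓ p} (G : FiniteGroup c ℓ) (H : SubsetOf G p) (isSubgroup : IsSubgroup G H) where

  open FiniteGroup G renaming (sym to ≈-sym; trans to ≈-trans; refl to ≈-refl)
  open Inverse enumeration
    using (to; from; to-cong; from-cong) renaming (strictlyInverseˡ to to-from; strictlyInverseʳ to from-to)
  open Subset H using (member?; resp)
  open IsSubgroup isSubgroup

  private
    -- On `Fin order` equality is propositional and decidable, as the counting arguments require.
    finRawGroup : RawGroup 0ℓ 0ℓ
    finRawGroup = record
      { Carrier = Fin order
      ; _≈_     = _≡_
      ; _∙_     = λ i j → to (from i ∙ from j)
      ; ε       = to ε
      ; _⁻¹     = λ i → to (from i ⁻¹)
      }

    from-isGroupMonomorphism : IsGroupMonomorphism finRawGroup (Group.rawGroup group) from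
    from-isGroupMonomorphism = record
      { isGroupHomomorphism = record
        { isMonoidHomomorphism = record
          { isMagmaHomomorphism = record
            { isRelHomomorphism = record { cong = from-cong }
            ; homo              = λ i j → from-to (from i ∙ from j)
            }
          ; ε-homo = from-to ε
          }
        ; ⁻¹-homo = λ i → from-to (from i ⁻¹)
        }
      ; injective = λ {i} {j} eq → trans (sym (to-from i)) (trans (to-cong eq) (to-from j))
      }

    h : Fin order → Bool
    h i = does (member? (from i))

    h⁺ : ∀ {i x} → from i ≈ x → x ∈ H → h i ≡ true
    h⁺ {i} i≈x x∈H = dec-true (member? (from i)) (resp (≈-sym i≈x) x∈H)

    h⁻ : ∀ {i} → h i ≡ true → from i ∈ H
    h⁻ {i} = does-true (member? (from i))

    module F = FinSubgroup
      (GroupMonomorphism.isGroup from-isGroupMonomorphism isGroup)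
      h
      (h⁺ (from-to ε) ε-closed)
      (λ hi hj → h⁺ (from-to _) (∙-closed _ _ (h⁻ hi) (h⁻ hj)))
      (λ hi → h⁺ (from-to _) (⁻¹-closed _ (h⁻ hi)))

    card-H : card H ≡ count h
    card-H = length-filter-tabulate member? from

    regularSet : ∀ {a b} → F.RegularConnectionSet a b → IsRegularSetOf G a b H
    regularSet {a} {b} R = S , connection , inside′ , outside′
      where
      open F.RegularConnectionSet R renaming (S to S₀)

      S : SubsetOf G 0ℓ
      S = record
        { member  = λ x → T (S₀ (to x))
        ; member? = λ x → T? (S₀ (to x))
        ; resp    = λ x≈y → subst (λ i → T (S₀ i)) (to-cong x≈y)
        }

      to-⁻¹ : ∀ x → to (x ⁻¹) ≡ to (from (to x) ⁻¹)
      to-⁻¹ x = to-cong (⁻¹-cong (≈-sym (from-to x)))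

      connection : IsConnectionSet G S
      connection = record
        { ε∉S            = subst T ε∉S
        ; inverse-closed = λ x → subst T (sym (trans (cong S₀ (to-⁻¹ x)) (inverse-closed (to x))))
        }

      -- The argument of `S₀` is the product of `i` and the inverse of `to x` in the transported
      -- group, written out.
      card-neighbours : ∀ x →
        card (FiniteSimpleGraph.neighbours (Cay G S connection) x ∩ H)
          ≡ count (λ i → S₀ (to (from i ∙ from (to (from (to x) ⁻¹)))) ∧ h i)
      card-neighbours x = trans
        (length-filter-tabulate (Subset.member? (FiniteSimpleGraph.neighbours (Cay G S connection) x ∩ H)) from)
        (count-cong λ i → cong (λ j → S₀ j ∧ h i)
          (to-cong (∙-congˡ (≈-trans (≈-sym (from-to (x ⁻¹))) (from-cong (to-⁻¹ x))))))

      inside′ : ∀ x → x ∈ H → card (FiniteSimpleGraph.neighbours (Cay G S connection) x ∩ H) ≡ a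
      inside′ x x∈H = trans (card-neighbours x) (inside (h⁺ (from-to x) x∈H))

      outside′ : ∀ x → x ∉ H → card (FiniteSimpleGraph.neighbours (Cay G S connection) x ∩ H) ≡ b
      outside′ x x∉H = trans (card-neighbours x)
        (outside (dec-false (member? (from (to x))) (x∉H ∘ resp (from-to x))))

  evenRegularSet : ∀ a b → a ≤ card H ∸ 1 → 2 ∣ b → b ≤ card H →
    gcd 2 (card H ∸ 1) ∣ a → IsRegularSetOf G a b H
  evenRegularSet a _ a≤ (divides-refl q) b≤ gcd∣a rewrite card-H =
    regularSet (F.regularConnectionSet a q a≤ b≤ (gcd∣⇒evenOrCoeven a≤ gcd∣a))

theoremB : {c ℓ p : Level} (G : FiniteGroup c ℓ) (H : SubsetOf G p) →
    IsSubgroup G H → NonTrivial G H →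
    (a b : ℕ) → a ≤ card H ∸ 1 → 2 ∣ b → b ≤ card H →
    gcd 2 (card H ∸ 1) ∣ a →
    IsRegularSetOf G a b H
theoremB G H isSubgroup _ = evenRegularSet G H isSubgroup
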